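{- Let $r\geq 1$ be an integer, let $s,\epsilon\in\{0,1\}$, and let $n=4r+2s+\epsilon$. Then there exists a Cayley graph (of a finite group) of diameter two, of degree $d=2n-s+\epsilon$, and of order $\frac12(d+s-\epsilon)^2$.
   Context: For a finite group $\Gamma$ and a generating set $X$ of $\Gamma$ that is unit-free (does not contain the identity) and inverse-closed ($X=X^{ -1}$), the Cayley graph $Cay(\Gamma,X)$ is the undirected simple graph with vertex set $\Gamma$ and edge set $\{\{g,h\} : g\in\Gamma,\ g^{ -1}h\in X\}$. Its degree is $|X|$ and its order is its number of vertices $|\Gamma|$. The diameter of a graph is the maximum distance between two of its vertices. -}

module Defs where

open import Algebra.Bundles using (Group)
open import Data.Fin.Base using (Fin)
open import Data.Nat.Base using (ℕ; zero; suc; _≤_; _<_)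
open import Data.Product.Base using (Σ; ∃-syntax; _×_; _,_; proj₁)
open import Function.Bundles using (Inverse)
open import Level using (0ℓ)
open import Relation.Binary.Bundles using (Setoid)
open import Relation.Binary.Core using (Rel)
open import Relation.Binary.Definitions using (Irreflexive; Symmetric; _Respects₂_)
import Relation.Binary.Construct.On as On
import Relation.Binary.PropositionalEquality.Properties as ≡
open import Relation.Nullary.Negation.Core using (¬_)
open import Relation.Unary using (Pred)
import Relation.Binary.Reasoning.Setoid as SetoidReasoning
import Algebra.Properties.Group as GroupProperties

HasCardinality : Setoid 0ℓ 0ℓ → ℕ → Set
HasCardinality S n = Inverse S (≡.setoid (Fin n))

-- The vertices form a setoid because groups in the library do.
record SimpleGraph : Set₁ where
  infix 4 _~_
  field
    vertices : Setoid 0ℓ 0ℓ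
  open Setoid vertices public using (_≈_) renaming (Carrier to Vertex)
  field
    _~_      : Rel Vertex 0ℓ
    ~-resp-≈ : _~_ Respects₂ _≈_
    ~-sym    : Symmetric _~_
    ~-irrefl : Irreflexive _≈_ _~_

module _ (G : SimpleGraph) where
  open SimpleGraph G

  data Walk : ℕ → Vertex → Vertex → Set where
    stop : ∀ {u v} → u ≈ v → Walk zero u v
    step : ∀ {k u w v} → u ~ w → Walk k w v → Walk (suc k) u v

  IsDistance : Vertex → Vertex → ℕ → Set
  IsDistance u v k = Walk k u v × (∀ j → j < k → ¬ Walk j u v)

  HasDiameter : ℕ → Set
  HasDiameter D =
      (∀ u v → ∃[ k ] (k ≤ D × IsDistance u v k))
    × (∃[ u ] ∃[ v ] IsDistance u v D)

  -- For a Cayley graph this also makes the group finite.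
  HasOrder : ℕ → Set
  HasOrder = HasCardinality vertices

module _ (Γ : Group 0ℓ 0ℓ) where
  open Group Γ

  data Generated (X : Pred Carrier 0ℓ) : Pred Carrier 0ℓ where
    gen  : ∀ {g} → X g → Generated X g
    unit : Generated X ε
    mul  : ∀ {g h} → Generated X g → Generated X h → Generated X (g ∙ h)
    inv  : ∀ {g} → Generated X g → Generated X (g ⁻¹)
    resp : ∀ {g h} → g ≈ h → Generated X g → Generated X h

  record ConnectionSet : Set₁ where
    field
      X              : Pred Carrier 0ℓ
      X-resp-≈       : ∀ {g h} → g ≈ h → X g → X h
      unit-free      : ¬ X ε
      inverse-closed : ∀ {g} → X g → X (g ⁻¹)
      generating     : ∀ g → Generated X g

    -- Membership proofs are ignored, so that cardinality counts group elements.
    elements : Setoid 0ℓ 0ℓ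
    elements = On.setoid {B = Σ Carrier X} setoid proj₁

module _ (Γ : Group 0ℓ 0ℓ) (S : ConnectionSet Γ) where
  open Group Γ
  open ConnectionSet S
  open GroupProperties Γ using (⁻¹-anti-homo-∙; ⁻¹-involutive)

  Cay : SimpleGraph
  Cay = record
    { vertices = setoid
    ; _~_      = λ g h → X (g ⁻¹ ∙ h)
    ; ~-resp-≈ = (λ p → X-resp-≈ (∙-congˡ p))
               , (λ p → X-resp-≈ (∙-congʳ (⁻¹-cong p)))
    ; ~-sym    = λ {g} {h} x → X-resp-≈ (flip g h) (inverse-closed x)
    ; ~-irrefl = λ {g} {h} p x →
        unit-free (X-resp-≈ (trans (∙-congˡ (sym p)) (inverseˡ g)) x)
    }
    where
    open SetoidReasoning setoid
    flip : ∀ g h → (g ⁻¹ ∙ h) ⁻¹ ≈ h ⁻¹ ∙ g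
    flip g h = begin
      (g ⁻¹ ∙ h) ⁻¹    ≈⟨ ⁻¹-anti-homo-∙ (g ⁻¹) h ⟩
      h ⁻¹ ∙ g ⁻¹ ⁻¹   ≈⟨ ∙-congˡ (⁻¹-involutive g) ⟩
      h ⁻¹ ∙ g         ∎

  -- Left translation by g matches X with the neighbours of g, so Cay is
  -- |X|-regular.
  CayHasDegree : ℕ → Set
  CayHasDegree = HasCardinality elements

{-# OPTIONS --safe #-}

-- Write n = 2m + ε, so that m = 2r + s, and work in (ℤ/n × ℤ/n) ⋊ ℤ₂, where the
-- involution swaps the two coordinates; elements (a , b) with trivial ℤ₂-part
-- are called rotations, the others reflections.  The connection set consists of
--
--   H  : the reflections (q , 0),   1 ≤ q ≤ m,       V : their inverses (0 , −q),
--   A  : the involutions (−p , p),  0 ≤ p ≤ m − 2 + 2ε,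
--   T⁺ : the rotations (t , m − t), 0 ≤ t ≤ r,       T⁻ : their inverses (−t , t − m).
--
-- For ε = 0 the rotation (0 , m) is its own inverse, so T⁻ starts at t = 1; no other
-- coincidences occur.  Whether (a , b) is a product of two generators is decided by
-- the sum a + b, and since inversion negates this sum in both cosets, one may choose its
-- sign.  A rotation of sum q ∈ [1 , m] lies in A·H or H·A unless both coordinates avoid
-- the residues −p, in which case it is in H·H or V·V.  A reflection of sum q ± m is in
-- H·T± or T±·H according to its second coordinate, because the t and m − t
-- together exhaust [0 , m].  The remaining rotations have sum 0 and lie in A·A, T⁺·T⁺ or
-- H·H; the remaining reflections have sum 0 or ±m and lie in A, A·T± or T±·A.
module Submission where

open import Defs
open import Algebra.Bundles using (Group)
import Algebra.Properties.Group as GroupProperties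
open import Data.Bool.Base using (Bool; true; false; not)
open import Data.Fin.Base using (Fin; fromℕ<; toℕ)
import Data.Fin.Properties as Fin
open import Data.Integer.Base as ℤ using (ℤ; +_; -_)
open import Data.Integer.Divisibility.Signed using (_∣_; divides; ∣⇒∣ᵤ; ∣m∣n⇒∣m+n; ∣m⇒∣-m)
import Data.Integer.DivMod as ℤ
import Data.Integer.Properties as ℤ
open import Data.Integer.Tactic.RingSolver using (solve-∀)
open import Data.Nat.Base as ℕ using (ℕ; zero; suc; z≤n; s≤s; NonZero; _+_; _*_; _∸_; _^_; _≤_; _<_)
import Data.Nat.Divisibility as ℕ
import Data.Nat.Properties as ℕ
import Data.Nat.Tactic.RingSolver as ℕ
open import Data.Product.Base using (Σ-syntax; ∃₂; ∃-syntax; _×_; _,_; proj₁; proj₂)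
open import Data.Product.Function.NonDependent.Setoid using (_×-inverse_)
open import Data.Product.Relation.Binary.Pointwise.NonDependent using (_×ₛ_; Pointwise-≡↔≡)
open import Data.Sum.Base using (_⊎_; inj₁; inj₂)
open import Data.Sum.Function.Propositional using (_⊎-↔_)
open import Function.Base using (_∘_)
open import Function.Bundles using (Inverse; _↔_)
open import Function.Construct.Composition using (inverse)
open import Function.Construct.Identity using (↔-id)
open import Function.Construct.Symmetry using () renaming (inverse to symmetric)
open import Level using (0ℓ)
open import Relation.Binary.Bundles using (Setoid)
open import Relation.Binary.PropositionalEquality as ≡ using (_≡_; refl; cong; subst)
open import Relation.Nullary.Decidable using (Dec; yes; no; map′)
open import Relation.Nullary.Negation using (¬_; contradiction)
open import Relation.Unary using (Pred; Decidable)

-- Products of two generators and diameter two.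

module _ (Γ : Group 0ℓ 0ℓ) where
  open Group Γ renaming (refl to ≈-refl; sym to ≈-sym; trans to ≈-trans)
  open GroupProperties Γ using (⁻¹-anti-homo-∙; ⁻¹-involutive; ε⁻¹≈ε; \\-leftDividesʳ)

  data Short (X : Pred Carrier 0ℓ) (g : Carrier) : Set where
    single  : X g → Short X g
    product : ∀ {x y} → X x → X y → g ≈ x ∙ y → Short X g

  short⇒generated : ∀ {X g} → Short X g → Generated Γ X g
  short⇒generated (single x)            = gen x
  short⇒generated (product x y g≈x∙y)   = resp (≈-sym g≈x∙y) (mul (gen x) (gen y))

  module _ {X : Pred Carrier 0ℓ}
           (X-resp-≈ : ∀ {g h} → g ≈ h → X g → X h)
           (inverse-closed : ∀ {g} → X g → X (g ⁻¹)) where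

    short-resp-≈ : ∀ {g h} → g ≈ h → Short X g → Short X h
    short-resp-≈ g≈h (single x)          = single (X-resp-≈ g≈h x)
    short-resp-≈ g≈h (product x y g≈x∙y) = product x y (≈-trans (≈-sym g≈h) g≈x∙y)

    -- Inverting x ∙ y gives y ⁻¹ ∙ x ⁻¹, again a product of two generators. This is what later
    -- permits choosing the sign of a coordinate sum.
    short-from-⁻¹ : ∀ {g} → Short X (g ⁻¹) → Short X g
    short-from-⁻¹ {g} = short-resp-≈ (⁻¹-involutive g) ∘ short-⁻¹
      where
      short-⁻¹ : ∀ {g} → Short X g → Short X (g ⁻¹)
      short-⁻¹ (single x)          = single (inverse-closed x)
      short-⁻¹ (product x y g≈x∙y) =
        product (inverse-closed y) (inverse-closed x) (≈-trans (⁻¹-cong g≈x∙y) (⁻¹-anti-homo-∙ _ _))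

  module _ (S : ConnectionSet Γ) where
    open ConnectionSet S

    -- By left translation only u ⁻¹ ∙ v matters, and a factorisation x ∙ y of it yields the
    -- midpoint u ∙ x. Distances must be exact, so decidability is used to tell 0, 1 and 2 apart;
    -- `g` shows that 2 is attained.
    hasDiameter-two : (∀ g h → Dec (g ≈ h)) → Decidable X → (∀ g → Short X g) →
                      ∀ g → ¬ g ≈ ε → ¬ X g → HasDiameter (Cay Γ S) 2
    hasDiameter-two _≟_ X? short g g≉ε g∉X = bounded , ε , g , distance-two ε g ε≉g ε≁g
      where
      ε⁻¹∙g≈g : ε ⁻¹ ∙ g ≈ g
      ε⁻¹∙g≈g = ≈-trans (∙-congʳ ε⁻¹≈ε) (identityˡ g)

      ε≉g : ¬ ε ≈ g
      ε≉g = g≉ε ∘ ≈-sym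

      ε≁g : ¬ X (ε ⁻¹ ∙ g)
      ε≁g = g∉X ∘ X-resp-≈ ε⁻¹∙g≈g

      no-walk-0 : ∀ {u v} → ¬ u ≈ v → ¬ Walk (Cay Γ S) 0 u v
      no-walk-0 u≉v (stop u≈v) = u≉v u≈v

      no-walk-1 : ∀ {u v} → ¬ X (u ⁻¹ ∙ v) → ¬ Walk (Cay Γ S) 1 u v
      no-walk-1 u≁v (step x (stop w≈v)) = u≁v (X-resp-≈ (∙-congˡ w≈v) x)

      distance-two : ∀ u v → ¬ u ≈ v → ¬ X (u ⁻¹ ∙ v) → IsDistance (Cay Γ S) u v 2
      distance-two u v u≉v u≁v with short (u ⁻¹ ∙ v)
      ... | single x      = contradiction x u≁v
      ... | product {x} {y} x∈X y∈X p = step u~ux (step ux~v (stop ≈-refl)) , shorter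
        where
        u~ux : X (u ⁻¹ ∙ (u ∙ x))
        u~ux = X-resp-≈ (≈-sym (\\-leftDividesʳ u x)) x∈X

        ux~v : X ((u ∙ x) ⁻¹ ∙ v)
        ux~v = X-resp-≈ (≈-sym
          (≈-trans (∙-congʳ (⁻¹-anti-homo-∙ u x))
          (≈-trans (assoc (x ⁻¹) (u ⁻¹) v)
          (≈-trans (∙-congˡ p) (\\-leftDividesʳ x y))))) y∈X

        shorter : ∀ j → j < 2 → ¬ Walk (Cay Γ S) j u v
        shorter 0 _ = no-walk-0 u≉v
        shorter 1 _ = no-walk-1 u≁v
        shorter (suc (suc _)) (s≤s (s≤s ()))

      bounded : ∀ u v → ∃[ k ] (k ≤ 2 × IsDistance (Cay Γ S) u v k)
      bounded u v with u ≟ v | X? (u ⁻¹ ∙ v)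
      ... | yes u≈v | _      = 0 , z≤n , stop u≈v , λ _ ()
      ... | no u≉v  | yes x  = 1 , s≤s z≤n , step x (stop ≈-refl) , λ { 0 _ → no-walk-0 u≉v ; (suc _) (s≤s ()) }
      ... | no u≉v  | no u≁v = 2 , ℕ.≤-refl , distance-two u v u≉v u≁v

-- The wreath product with ℤ₂.

module _ (G : Group 0ℓ 0ℓ) where
  private module G = Group G
  open Group G using (Carrier; _∙_; _⁻¹; assoc; identityˡ; identityʳ; inverseˡ; inverseʳ; ∙-cong; ⁻¹-cong)

  wreathSetoid : Setoid 0ℓ 0ℓ
  wreathSetoid = (G.setoid ×ₛ G.setoid) ×ₛ ≡.setoid Bool

  _≀ℤ₂ : Group 0ℓ 0ℓ
  _≀ℤ₂ = record
    { Carrier = (Carrier × Carrier) × Bool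
    ; _≈_     = Setoid._≈_ wreathSetoid
    ; _∙_     = _·_
    ; ε       = (G.ε , G.ε) , false
    ; _⁻¹     = inv′
    ; isGroup = record
      { isMonoid = record
        { isSemigroup = record
          { isMagma = record
            { isEquivalence = Setoid.isEquivalence wreathSetoid
            ; ∙-cong        = λ {g} {h} {k} {l} → ·-cong {g} {h} {k} {l} }
          ; assoc = ·-assoc }
        ; identity = (λ _ → (identityˡ _ , identityˡ _) , refl)
                   , (λ { (_ , false) → (identityʳ _ , identityʳ _) , refl
                        ; (_ , true)  → (identityʳ _ , identityʳ _) , refl }) }
      ; inverse = (λ { (_ , false) → (inverseˡ _ , inverseˡ _) , refl
                     ; (_ , true)  → (inverseˡ _ , inverseˡ _) , refl })
                , (λ { (_ , false) → (inverseʳ _ , inverseʳ _) , refl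
                     ; (_ , true)  → (inverseʳ _ , inverseʳ _) , refl })
      ; ⁻¹-cong = λ {g} {h} → inv′-cong {g} {h} } }
    where
    W = (Carrier × Carrier) × Bool
    open Setoid wreathSetoid using (_≈_)

    _·_ : W → W → W
    ((a , b) , false) · ((c , d) , u) = (a ∙ c , b ∙ d) , u
    -- A reflection swaps the coordinates of the factor to its right, so the order of the factors
    -- decides which coordinate can be adjusted.
    ((a , b) , true)  · ((c , d) , u) = (a ∙ d , b ∙ c) , not u

    inv′ : W → W
    inv′ ((a , b) , false) = (a ⁻¹ , b ⁻¹) , false
    inv′ ((a , b) , true)  = (b ⁻¹ , a ⁻¹) , true

    ·-cong : ∀ {g h k l} → g ≈ h → k ≈ l → (g · k) ≈ (h · l)
    ·-cong {_ , false} ((p , q) , refl) ((r , s) , refl) = (∙-cong p r , ∙-cong q s) , refl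
    ·-cong {_ , true}  ((p , q) , refl) ((r , s) , refl) = (∙-cong p s , ∙-cong q r) , refl

    ·-assoc : ∀ g h k → ((g · h) · k) ≈ (g · (h · k))
    ·-assoc (_ , false) (_ , false) (_ , _)     = (assoc _ _ _ , assoc _ _ _) , refl
    ·-assoc (_ , false) (_ , true)  (_ , _)     = (assoc _ _ _ , assoc _ _ _) , refl
    ·-assoc (_ , true)  (_ , false) (_ , _)     = (assoc _ _ _ , assoc _ _ _) , refl
    ·-assoc (_ , true)  (_ , true)  (_ , false) = (assoc _ _ _ , assoc _ _ _) , refl
    ·-assoc (_ , true)  (_ , true)  (_ , true)  = (assoc _ _ _ , assoc _ _ _) , refl

    inv′-cong : ∀ {g h} → g ≈ h → inv′ g ≈ inv′ h
    inv′-cong {_ , false} ((p , q) , refl) = (⁻¹-cong p , ⁻¹-cong q) , refl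
    inv′-cong {_ , true}  ((p , q) , refl) = (⁻¹-cong q , ⁻¹-cong p) , refl

-- Cardinalities and decidable equality.

×-order : ∀ {A B : Setoid 0ℓ 0ℓ} {k l} → HasCardinality A k → HasCardinality B l → HasCardinality (A ×ₛ B) (k * l)
×-order f g = inverse (f ×-inverse g) (inverse Pointwise-≡↔≡ (symmetric Fin.*↔×))

wreath-order : ∀ G {n} → HasCardinality (Group.setoid G) n → HasCardinality (Group.setoid (G ≀ℤ₂)) (n * n * 2)
wreath-order _ f = ×-order (×-order f f) (symmetric Fin.2↔Bool)

⊎-order : ∀ {A B : Set} {k l} → A ↔ Fin k → B ↔ Fin l → (A ⊎ B) ↔ Fin (k + l)
⊎-order f g = inverse (f ⊎-↔ g) (symmetric Fin.+↔⊎)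

cardinality⇒≈? : ∀ {S : Setoid 0ℓ 0ℓ} {n} → HasCardinality S n → ∀ x y → Dec (Setoid._≈_ S x y)
cardinality⇒≈? {S} f x y = map′ injective to-cong (to x Fin.≟ to y)
  where
  open Inverse f
  open Setoid S using (trans; sym)
  injective : to x ≡ to y → Setoid._≈_ S x y
  injective p = trans (sym (strictlyInverseʳ x)) (trans (from-cong p) (strictlyInverseʳ y))

-- Connection sets given by a finite indexing.

module Indexed (Γ : Group 0ℓ 0ℓ) {I : Set} (e : I → Group.Carrier Γ) where
  open Group Γ renaming (refl to ≈-refl; sym to ≈-sym; trans to ≈-trans)

  Image : Pred Carrier 0ℓ
  Image g = ∃[ i ] g ≈ e i

  Image-resp-≈ : ∀ {g h} → g ≈ h → Image g → Image h
  Image-resp-≈ g≈h (i , p) = i , ≈-trans (≈-sym g≈h) p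

  module _ {d} (I↔Fin : I ↔ Fin d) where
    open Inverse I↔Fin

    Image? : (∀ g h → Dec (g ≈ h)) → Decidable Image
    Image? _≟_ g = map′ (λ (k , p) → from k , p)
                        (λ (i , p) → to i , subst (λ j → g ≈ e j) (≡.sym (strictlyInverseʳ i)) p)
                        (Fin.any? (λ k → g ≟ e (from k)))

    -- A membership proof carries an index, but `elements` compares group elements only; injectivity
    -- of `e` makes the index depend on the element alone.
    image-degree : (∀ i j → e i ≈ e j → i ≡ j) → (S : ConnectionSet Γ) →
                   ConnectionSet.X S ≡ Image → CayHasDegree Γ S d
    image-degree e-injective S refl = record
      { to        = λ (_ , i , _) → to i
      ; from      = λ k → e (from k) , from k , ≈-refl
      ; to-cong   = λ { {_ , i , p} {_ , j , q} g≈h →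
                        cong to (e-injective i j (≈-trans (≈-sym p) (≈-trans g≈h q))) }
      ; from-cong = λ { refl → ≈-refl }
      ; inverse   = (λ { {k} {_ , j , q} p → ≡.trans (cong to (e-injective j (from k) (≈-trans (≈-sym q) p))) (strictlyInverseˡ k) })
                  , (λ { {_ , i , p} refl → ≈-trans (Group.reflexive Γ (cong e (strictlyInverseʳ i))) (≈-sym p) })
      }

-- The integers modulo n.

module Congruence (n : ℕ) .{{_ : NonZero n}} where
  infix 4 _≈_
  -- A record, so that x and y can be inferred from a congruence; they could not be recovered from a
  -- bare divisibility of x - y.
  record _≈_ (x y : ℤ) : Set where
    constructor mod
    field n∣x-y : + n ∣ x ℤ.- y
  open _≈_

  private
    _by_ : ∀ {x y} → + n ∣ x → x ≡ y → + n ∣ y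
    p by refl = p

  reflexive : ∀ {x y} → x ≡ y → x ≈ y
  reflexive {x} refl = mod (divides (+ 0) (ℤ.+-inverseʳ x))

  ≈-sym : ∀ {x y} → x ≈ y → y ≈ x
  ≈-sym {x} {y} (mod p) = mod (∣m⇒∣-m p by lemma x y)
    where
    lemma : ∀ x y → - (x ℤ.- y) ≡ y ℤ.- x
    lemma = solve-∀

  ≈-trans : ∀ {x y z} → x ≈ y → y ≈ z → x ≈ z
  ≈-trans {x} {y} {z} (mod p) (mod q) = mod (∣m∣n⇒∣m+n p q by lemma x y z)
    where
    lemma : ∀ x y z → (x ℤ.- y) ℤ.+ (y ℤ.- z) ≡ x ℤ.- z
    lemma = solve-∀

  +-cong : ∀ {x y u v} → x ≈ y → u ≈ v → x ℤ.+ u ≈ y ℤ.+ v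
  +-cong {x} {y} {u} {v} (mod p) (mod q) = mod (∣m∣n⇒∣m+n p q by lemma x y u v)
    where
    lemma : ∀ x y u v → (x ℤ.- y) ℤ.+ (u ℤ.- v) ≡ (x ℤ.+ u) ℤ.- (y ℤ.+ v)
    lemma = solve-∀

  neg-cong : ∀ {x y} → x ≈ y → - x ≈ - y
  neg-cong {x} {y} (mod p) = mod (∣m⇒∣-m p by lemma x y)
    where
    lemma : ∀ x y → - (x ℤ.- y) ≡ - x ℤ.- - y
    lemma = solve-∀

  ℤ/n : Group 0ℓ 0ℓ
  ℤ/n = record
    { Carrier = ℤ ; _≈_ = _≈_ ; _∙_ = ℤ._+_ ; ε = + 0 ; _⁻¹ = -_
    ; isGroup = record
      { isMonoid = record
        { isSemigroup = record
          { isMagma = record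
            { isEquivalence = record { refl = reflexive refl ; sym = ≈-sym ; trans = ≈-trans }
            ; ∙-cong = +-cong }
          ; assoc = λ x y z → reflexive (ℤ.+-assoc x y z) }
        ; identity = (λ x → reflexive (ℤ.+-identityˡ x)) , (λ x → reflexive (ℤ.+-identityʳ x)) }
      ; inverse = (λ x → reflexive (ℤ.+-inverseˡ x)) , (λ x → reflexive (ℤ.+-inverseʳ x))
      ; ⁻¹-cong = neg-cong } }

  n≈0 : + n ≈ + 0
  n≈0 = mod (divides (+ 1) (≡.trans (ℤ.+-identityʳ (+ n)) (≡.sym (ℤ.*-identityˡ (+ n)))))

  residue : ∀ x → ∃[ k ] (k < n × x ≈ + k)
  residue x = x ℤ.%ℕ n , ℤ.n%ℕd<d x n ,
    mod (divides (x ℤ./ℕ n) (≡.trans (cong (ℤ._- + (x ℤ.%ℕ n)) (ℤ.a≡a%ℕn+[a/ℕn]*n x n)) (lemma (+ (x ℤ.%ℕ n)) _)))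
    where
    lemma : ∀ k y → (k ℤ.+ y) ℤ.- k ≡ y
    lemma = solve-∀

  -- A positive number divisible by n is at least n.
  small-zero : ∀ {k} → k < n → + k ≈ + 0 → k ≡ 0
  small-zero {zero}  _   _       = refl
  small-zero {suc k} k<n (mod p) = contradiction (ℕ.∣⇒≤ (∣⇒∣ᵤ (p by ℤ.+-identityʳ (+ suc k)))) (ℕ.<⇒≱ k<n)

  private
    small-injective-≤ : ∀ {k l} → k ≤ l → l < n → + l ≈ + k → l ≡ k
    small-injective-≤ {k} {l} k≤l l<n (mod p) with j , refl ← ℕ.m≤n⇒∃[o]m+o≡n k≤l =
      ≡.trans (cong (λ t → k + t) j≡0) (ℕ.+-identityʳ k)
      where
      lemma : ∀ k j → (k ℤ.+ j) ℤ.- k ≡ j ℤ.- + 0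
      lemma = solve-∀
      j≡0 : j ≡ 0
      j≡0 = small-zero (ℕ.≤-<-trans (ℕ.m≤n+m j k) l<n) (mod (p by lemma (+ k) (+ j)))

  small-injective : ∀ {k l} → k < n → l < n → + k ≈ + l → k ≡ l
  small-injective {k} {l} k<n l<n p with ℕ.≤-total k l
  ... | inj₁ k≤l = ≡.sym (small-injective-≤ k≤l l<n (≈-sym p))
  ... | inj₂ l≤k = small-injective-≤ l≤k k<n p

  ℤ/n-order : HasCardinality (Group.setoid ℤ/n) n
  ℤ/n-order = record
    { to        = to
    ; from      = λ i → + toℕ i
    ; to-cong   = λ {x} {y} p → Fin.fromℕ<-cong _ _
        (small-injective (bound x) (bound y) (≈-trans (≈-sym (eq x)) (≈-trans p (eq y)))) _ _
    ; from-cong = λ { refl → reflexive refl }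
    ; inverse   = (λ {i} {x} p → Fin.toℕ-injective (≡.trans (Fin.toℕ-fromℕ< (bound x))
                     (small-injective (bound x) (Fin.toℕ<n i) (≈-trans (≈-sym (eq x)) p))))
                , (λ { {x} refl → ≈-sym (≈-trans (eq x) (reflexive (cong +_ (≡.sym (Fin.toℕ-fromℕ< (bound x)))))) })
    }
    where
    bound : ∀ x → proj₁ (residue x) < n
    bound x = proj₁ (proj₂ (residue x))
    eq : ∀ x → x ≈ + proj₁ (residue x)
    eq x = proj₂ (proj₂ (residue x))
    to : ℤ → Fin n
    to x = fromℕ< (bound x)

-- The connection set and its closure under inversion.

module Construction (r m₁ ε : ℕ) (1≤r : 1 ≤ r) (ε≤1 : ε ≤ 1)
                    (2r≤m : r + r ≤ suc m₁) (m≤1+2r : suc m₁ ≤ suc (r + r)) where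

  m n : ℕ
  m = suc m₁
  n = m + m + ε

  open Congruence n

  W : Group 0ℓ 0ℓ
  W = ℤ/n ≀ℤ₂

  open Group W using (Carrier) renaming (_≈_ to _≋_; _∙_ to _·_; _⁻¹ to _⁻¹ʷ)

  Index : Set
  Index = (Fin m ⊎ Fin m) ⊎ (Fin (m₁ + (ε + ε)) ⊎ (Fin (suc r) ⊎ Fin (r + ε)))

  pattern H i  = inj₁ (inj₁ i)
  pattern V i  = inj₁ (inj₂ i)
  pattern A i  = inj₂ (inj₁ i)
  pattern T⁺ i = inj₂ (inj₂ (inj₁ i))
  pattern T⁻ i = inj₂ (inj₂ (inj₂ i))

  element : Index → Carrier
  element (H i)  = (+ suc (toℕ i) , + 0) , true
  element (V i)  = (+ 0 , - + suc (toℕ i)) , true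
  element (A i)  = (- + toℕ i , + toℕ i) , true
  element (T⁺ i) = (+ toℕ i , + m ℤ.- + toℕ i) , false
  -- The shift 1 ∸ ε drops t = 0 exactly when ε = 0.
  element (T⁻ i) = (- + ((1 ∸ ε) + toℕ i) , + ((1 ∸ ε) + toℕ i) ℤ.- + m) , false

  open Indexed W element renaming (Image to X; Image-resp-≈ to X-resp-≈)

  ε-cases : ε ≡ 0 ⊎ ε ≡ 1
  ε-cases = go ε≤1
    where
    go : ∀ {e} → e ≤ 1 → e ≡ 0 ⊎ e ≡ 1
    go z≤n       = inj₁ refl
    go (s≤s z≤n) = inj₂ refl

  r≤m : r ≤ m
  r≤m = ℕ.≤-trans (ℕ.m≤m+n r r) 2r≤m

  2≤m : 2 ≤ m
  2≤m = ℕ.≤-trans (ℕ.+-mono-≤ 1≤r 1≤r) 2r≤m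

  m<n : m < n
  m<n = ℕ.≤-trans (ℕ.+-monoˡ-≤ m {1} (s≤s z≤n)) (ℕ.m≤m+n (m + m) ε)

  ≤m⇒<n : ∀ {k} → k ≤ m → k < n
  ≤m⇒<n k≤m = ℕ.≤-<-trans k≤m m<n

  H∈ : ∀ {q} → 1 ≤ q → q ≤ m → X ((+ q , + 0) , true)
  H∈ {suc q} _ q≤m = H (fromℕ< q≤m) ,
    (reflexive (cong (λ k → + suc k) (≡.sym (Fin.toℕ-fromℕ< q≤m))) , reflexive refl) , refl

  V∈ : ∀ {q} → 1 ≤ q → q ≤ m → X ((+ 0 , - + q) , true)
  V∈ {suc q} _ q≤m = V (fromℕ< q≤m) ,
    (reflexive refl , reflexive (cong (λ k → - + suc k) (≡.sym (Fin.toℕ-fromℕ< q≤m)))) , refl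

  -- The hypothesis is p ≤ m - 2 + 2ε without truncated subtraction: up to m - 2 for ε = 0 and up to
  -- m for ε = 1.
  A∈ : ∀ {p} → 2 + p ≤ m + (ε + ε) → X ((- + p , + p) , true)
  A∈ (s≤s p<) = A (fromℕ< p<) ,
    (reflexive (cong (λ k → - + k) (≡.sym (Fin.toℕ-fromℕ< p<))) ,
     reflexive (cong +_ (≡.sym (Fin.toℕ-fromℕ< p<)))) , refl

  T⁺∈ : ∀ {t} → t ≤ r → X ((+ t , + m ℤ.- + t) , false)
  T⁺∈ {t} t≤r = T⁺ (fromℕ< t<) ,
    (reflexive (cong +_ (≡.sym (Fin.toℕ-fromℕ< t<))) ,
     reflexive (cong (λ k → + m ℤ.- + k) (≡.sym (Fin.toℕ-fromℕ< t<)))) , refl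
    where
    t< : t < suc r
    t< = s≤s t≤r

  2m≈0 : ε ≡ 0 → + m ℤ.+ + m ≈ + 0
  2m≈0 ε≡0 = ≈-trans (reflexive (cong +_ (≡.sym (≡.trans (cong (λ e → m + m + e) ε≡0) (ℕ.+-identityʳ (m + m)))))) n≈0

  -- The omitted index t = 0 for ε = 0 is recovered from `T⁺`, because then n = 2m and -m is
  -- congruent to m.
  T⁻∈ : ∀ {t} → t ≤ r → X ((- + t , + t ℤ.- + m) , false)
  T⁻∈ {t} t≤r = go t t≤r ε-cases
    where
    indexed : ∀ t j → (1 ∸ ε) + j ≡ t → j < r + ε → X ((- + t , + t ℤ.- + m) , false)
    indexed t j eq j< = T⁻ (fromℕ< j<) ,
      (reflexive (cong (λ k → - + k) t≡) , reflexive (cong (λ k → + k ℤ.- + m) t≡)) , refl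
      where
      t≡ : t ≡ (1 ∸ ε) + toℕ (fromℕ< j<)
      t≡ = ≡.trans (≡.sym eq) (cong (λ k → (1 ∸ ε) + k) (≡.sym (Fin.toℕ-fromℕ< j<)))
    m-0≈0-m : ε ≡ 0 → + 0 ℤ.- + m ≈ + m ℤ.- + 0
    m-0≈0-m ε≡0 = ≈-trans (+-cong {u = - + m} (≈-sym (2m≈0 ε≡0)) (reflexive refl)) (reflexive (lemma (+ m)))
      where
      lemma : ∀ m → (m ℤ.+ m) ℤ.- m ≡ m ℤ.- + 0
      lemma = solve-∀
    go : ∀ t → t ≤ r → ε ≡ 0 ⊎ ε ≡ 1 → X ((- + t , + t ℤ.- + m) , false)
    go zero    _   (inj₁ ε≡0) = X-resp-≈ ((reflexive refl , ≈-sym (m-0≈0-m ε≡0)) , refl) (T⁺∈ z≤n)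
    go (suc t) t<r (inj₁ ε≡0) = indexed _ t (cong (λ e → (1 ∸ e) + t) ε≡0) (ℕ.≤-trans t<r (ℕ.m≤m+n r ε))
    go t       t≤r (inj₂ ε≡1) = indexed _ t (cong (λ e → (1 ∸ e) + t) ε≡1)
      (ℕ.≤-trans (s≤s t≤r) (ℕ.≤-reflexive (≡.trans (ℕ.+-comm 1 r) (cong (λ e → r + e) (≡.sym ε≡1)))))

  -- Shift and length compensate: the last t is (1 - ε) + (r + ε - 1) = r for either ε.
  T⁻-bound : ∀ (i : Fin (r + ε)) → (1 ∸ ε) + toℕ i ≤ r
  T⁻-bound i with ε-cases
  ... | inj₁ ε≡0 = subst (λ e → (1 ∸ e) + toℕ i ≤ r) (≡.sym ε≡0)
                     (subst (toℕ i <_) (≡.trans (cong (λ e → r + e) ε≡0) (ℕ.+-identityʳ r)) (Fin.toℕ<n i))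
  ... | inj₂ ε≡1 = subst (λ e → (1 ∸ e) + toℕ i ≤ r) (≡.sym ε≡1)
                     (ℕ.s≤s⁻¹ (subst (toℕ i <_) (≡.trans (cong (λ e → r + e) ε≡1) (ℕ.+-comm r 1)) (Fin.toℕ<n i)))

  inverse-closed : ∀ {g} → X g → X (g ⁻¹ʷ)
  inverse-closed {g} (i , g≋) = X-resp-≈ (Group.sym W (Group.⁻¹-cong W {g} {element i} g≋)) (element⁻¹ i)
    where
    lemma : ∀ x y → - (x ℤ.- y) ≡ y ℤ.- x
    lemma = solve-∀
    element⁻¹ : ∀ i → X (element i ⁻¹ʷ)
    element⁻¹ (H i)  = V∈ (s≤s z≤n) (Fin.toℕ<n i)
    element⁻¹ (V i)  = H∈ (s≤s z≤n) (Fin.toℕ<n i)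
    element⁻¹ (A i)  = X-resp-≈ ((reflexive refl , reflexive (≡.sym (ℤ.neg-involutive _))) , refl) (A∈ (s≤s (Fin.toℕ<n i)))
    element⁻¹ (T⁺ i) = X-resp-≈ ((reflexive refl , reflexive (≡.sym (lemma (+ m) (+ toℕ i)))) , refl) (T⁻∈ (ℕ.s≤s⁻¹ (Fin.toℕ<n i)))
    element⁻¹ (T⁻ i) = X-resp-≈ ((reflexive (≡.sym (ℤ.neg-involutive _)) , reflexive (≡.sym (lemma (+ ((1 ∸ ε) + toℕ i)) (+ m)))) , refl) (T⁺∈ (T⁻-bound i))

  -- Locating residues and pairs modulo n.

  infixl 5 _⨾_
  _⨾_ : ∀ {x y z} → x ≈ y → y ≡ z → x ≈ z
  p ⨾ refl = p

  -- The second coordinate is the sum minus the first. Every factorisation below is thus checked on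
  -- one coordinate and the sum.
  from-fst : ∀ {a b α β σ} → a ≈ α → a ℤ.+ b ≈ σ → α ℤ.+ β ≈ σ → a ≈ α × b ≈ β
  from-fst {a} {b} {α} {β} p sum sum′ = p ,
    ≈-trans (reflexive (≡.sym (lemma a b))) (+-cong (neg-cong p) (≈-trans sum (≈-sym sum′)) ⨾ lemma α β)
    where
    lemma : ∀ a b → - a ℤ.+ (a ℤ.+ b) ≡ b
    lemma = solve-∀

  from-snd : ∀ {a b α β σ} → b ≈ β → a ℤ.+ b ≈ σ → α ℤ.+ β ≈ σ → a ≈ α × b ≈ β
  from-snd {a} {b} {α} {β} p sum sum′ = q , p
    where
    lemma : ∀ a b → (a ℤ.+ b) ℤ.+ - b ≡ a
    lemma = solve-∀
    q : a ≈ α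
    q = ≈-trans (reflexive (≡.sym (lemma a b))) (+-cong (≈-trans sum (≈-sym sum′)) (neg-cong p) ⨾ lemma α β)

  wrap : ∀ {x k l} → x ≈ + k → k + l ≡ n → x ≈ - + l
  wrap {x} {k} {l} p k+l≡n = proj₁ (from-snd {b = + l} (reflexive refl)
    (≈-trans (+-cong p (reflexive refl)) (reflexive (cong +_ k+l≡n))) (≈-trans (reflexive (ℤ.+-inverseˡ (+ l))) (≈-sym n≈0)))

  ≤⇒∃+ : ∀ {k l} → k ≤ l → ∃[ j ] j + k ≡ l
  ≤⇒∃+ {k} {l} k≤l = l ∸ k , ℕ.m∸n+n≡m k≤l

  -- A residue k above m is replaced by -(n - k), and n - k ≤ m since n ≤ 2m + 1.
  halves : ∀ x → ∃[ k ] (k ≤ m × (x ≈ + k ⊎ x ≈ - + k))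
  halves x with k , k<n , p ← residue x with k ℕ.≤? m
  ... | yes k≤m = k , k≤m , inj₁ p
  ... | no  k≰m with l , l+k≡n ← ≤⇒∃+ (ℕ.<⇒≤ k<n) = l , l≤m , inj₂ (wrap p (≡.trans (ℕ.+-comm k l) l+k≡n))
    where
    l≤m : l ≤ m
    l≤m = ℕ.+-cancelʳ-≤ (suc m) l m (begin
      l + suc m       ≤⟨ ℕ.+-monoʳ-≤ l (ℕ.≰⇒> k≰m) ⟩
      l + k           ≡⟨ l+k≡n ⟩
      m + m + ε       ≤⟨ ℕ.+-monoʳ-≤ (m + m) ε≤1 ⟩
      m + m + 1       ≡⟨ ℕ.+-assoc m m 1 ⟩
      m + (m + 1)     ≡⟨ cong (λ k → m + k) (ℕ.+-comm m 1) ⟩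
      m + suc m       ∎)
      where open ℕ.≤-Reasoning

  -- The difference k - q lies strictly between 0 and n.
  gap : ∀ {k q} → q < k → k < q + n → ¬ + k ≈ + q
  gap {k} {q} q<k k<q+n p with j , refl ← ≤⇒∃+ (ℕ.<⇒≤ q<k) =
    ℕ.<-irrefl (≡.sym (cong (λ i → i + q) (small-zero j<n j≈0))) q<k
    where
    j<n : j < n
    j<n = ℕ.+-cancelʳ-< q j n (subst (j + q <_) (ℕ.+-comm q n) k<q+n)
    j≈0 : + j ≈ + 0
    j≈0 = proj₁ (from-snd {b = + q} (reflexive refl) p (reflexive (ℤ.+-identityˡ (+ q))))

  -- The residues -p occurring in `A` are 0 and those from m + 2 - ε up to n - 1, which leaves the
  -- interval from 1 to m + 1 - ε.
  A-or-small : ∀ x → (∃[ p ] (2 + p ≤ m + (ε + ε) × x ≈ - + p)) ⊎ (∃[ α ] (1 ≤ α × α + ε ≤ suc m × x ≈ + α))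
  A-or-small x with k , k<n , q ← residue x with k
  ... | zero  = inj₁ (0 , ℕ.≤-trans 2≤m (ℕ.m≤m+n m (ε + ε)) , q)
  ... | suc k′ with suc k′ + ε ℕ.≤? suc m
  ...   | yes small = inj₂ (suc k′ , s≤s z≤n , small , q)
  ...   | no  large with l , l+k≡n ← ≤⇒∃+ (ℕ.<⇒≤ k<n) = inj₁ (l , 2+l≤ , wrap q (≡.trans (ℕ.+-comm (suc k′) l) l+k≡n))
    where
    2+l≤ : 2 + l ≤ m + (ε + ε)
    2+l≤ = ℕ.+-cancelʳ-≤ m (2 + l) (m + (ε + ε)) (begin
      2 + l + m          ≡⟨ cong (λ i → 2 + i) (ℕ.+-comm l m) ⟩
      2 + m + l          ≤⟨ ℕ.+-monoˡ-≤ l (ℕ.≰⇒> large) ⟩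
      suc k′ + ε + l     ≡⟨ ℕ.+-comm (suc k′ + ε) l ⟩
      l + (suc k′ + ε)   ≡⟨ ℕ.+-assoc l (suc k′) ε ⟨
      l + suc k′ + ε     ≡⟨ cong (λ i → i + ε) l+k≡n ⟩
      m + m + ε + ε      ≡⟨ lemma m ε ⟩
      m + (ε + ε) + m    ∎)
      where
      open ℕ.≤-Reasoning
      lemma : ∀ m ε → m + m + ε + ε ≡ m + (ε + ε) + m
      lemma = ℕ.solve-∀

  -- Rotations as products of two generators.

  ShortX : Carrier → Set
  ShortX = Short W X

  by-inverse : ∀ {g} → ShortX (Group._⁻¹ W g) → ShortX g
  by-inverse = short-from-⁻¹ W (λ {g} {h} → X-resp-≈ {g} {h}) (λ {g} → inverse-closed {g})

  neg-sum : ∀ a b {σ} → a ℤ.+ b ≈ - σ → - a ℤ.+ - b ≈ σ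
  neg-sum a b {σ} sum = ≈-trans (reflexive (lemma a b)) (neg-cong sum ⨾ ℤ.neg-involutive σ)
    where
    lemma : ∀ a b → - a ℤ.+ - b ≡ - (a ℤ.+ b)
    lemma = solve-∀

  module _ {a b : ℤ} where

    -- The factor from `A` has sum 0 and so only sets the first coordinate, while the factor from
    -- `H` supplies the sum q. The reversed product in `rotation-HA` sets the second coordinate
    -- instead.
    rotation-AH : ∀ {p q} → 2 + p ≤ m + (ε + ε) → 1 ≤ q → q ≤ m → a ≈ - + p → a ℤ.+ b ≈ + q → ShortX ((a , b) , false)
    rotation-AH {p} {q} p< 1≤q q≤m a≈ sum = product (A∈ p<) (H∈ 1≤q q≤m)
      (from-fst (a≈ ⨾ ≡.sym (ℤ.+-identityʳ _)) sum (reflexive (lemma (+ p) (+ q))) , refl)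
      where
      lemma : ∀ p q → (- p ℤ.+ + 0) ℤ.+ (p ℤ.+ q) ≡ q
      lemma = solve-∀

    rotation-HA : ∀ {p q} → 2 + p ≤ m + (ε + ε) → 1 ≤ q → q ≤ m → b ≈ - + p → a ℤ.+ b ≈ + q → ShortX ((a , b) , false)
    rotation-HA {p} {q} p< 1≤q q≤m b≈ sum = product (H∈ 1≤q q≤m) (A∈ p<)
      (from-snd (b≈ ⨾ ≡.sym (ℤ.+-identityˡ _)) sum (reflexive (lemma (+ p) (+ q))) , refl)
      where
      lemma : ∀ p q → (q ℤ.+ p) ℤ.+ (+ 0 ℤ.+ - p) ≡ q
      lemma = solve-∀

    rotation-HH : ∀ {q q′} → 1 ≤ q → q ≤ m → 1 ≤ q′ → q′ ≤ m → a ≈ + q → b ≈ + q′ → ShortX ((a , b) , false)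
    rotation-HH 1≤q q≤m 1≤q′ q′≤m a≈ b≈ = product (H∈ 1≤q q≤m) (H∈ 1≤q′ q′≤m)
      ((a≈ ⨾ ≡.sym (ℤ.+-identityʳ _) , b≈ ⨾ ≡.sym (ℤ.+-identityˡ _)) , refl)

    rotation-VV : ∀ {q q′} → 1 ≤ q → q ≤ m → 1 ≤ q′ → q′ ≤ m → a ≈ - + q → b ≈ - + q′ → ShortX ((a , b) , false)
    -- The left factor swaps the right one, so q, wanted in the first coordinate, comes from the
    -- right factor.
    rotation-VV 1≤q q≤m 1≤q′ q′≤m a≈ b≈ = product (V∈ 1≤q′ q′≤m) (V∈ 1≤q q≤m)
      ((a≈ ⨾ ≡.sym (ℤ.+-identityˡ _) , b≈ ⨾ ≡.sym (ℤ.+-identityʳ _)) , refl)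

  -- With n = 2m, the values m and m + 1 are -m and -(m - 1); both are in the range of `V` because m
  -- ≥ 2.
  antipode : ε ≡ 0 → ∀ {x α} → m ≤ α → α ≤ suc m → x ≈ + α → ∃[ l ] (1 ≤ l × l ≤ m × x ≈ - + l)
  antipode ε≡0 {x} {α} m≤α α≤1+m p with l , l+α≡n ← ≤⇒∃+ {α} {n} (ℕ.≤-trans α≤1+m m<n) =
    l , 1≤l , l≤m , wrap p (≡.trans (ℕ.+-comm α l) l+α≡n)
    where
    open ℕ.≤-Reasoning
    n≡2m : n ≡ m + m
    n≡2m = ≡.trans (cong (λ e → m + m + e) ε≡0) (ℕ.+-identityʳ (m + m))
    l≤m : l ≤ m
    l≤m = ℕ.+-cancelʳ-≤ m l m (begin
      l + m   ≤⟨ ℕ.+-monoʳ-≤ l m≤α ⟩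
      l + α   ≡⟨ l+α≡n ⟩
      n       ≡⟨ n≡2m ⟩
      m + m   ∎)
    1≤l : 1 ≤ l
    1≤l = ℕ.+-cancelʳ-≤ (suc m) 1 l (begin
      2 + m       ≤⟨ ℕ.+-monoˡ-≤ m 2≤m ⟩
      m + m       ≡⟨ n≡2m ⟨
      n           ≡⟨ l+α≡n ⟨
      l + α       ≤⟨ ℕ.+-monoʳ-≤ l α≤1+m ⟩
      l + suc m   ∎)

  -- Here α = m + 1. If β < m, then q < α + β < 2m + 1 ≤ q + n, which rules out the congruence.
  both-large : ∀ {α β q} → m < α → α ≤ suc m → q ≤ m → 1 ≤ q → + α ℤ.+ + β ≈ + q → m ≤ β
  both-large {α} {β} {q} m<α α≤1+m q≤m 1≤q p with m ℕ.≤? β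
  ... | yes m≤β = m≤β
  ... | no  m≰β = contradiction p (gap (ℕ.≤-trans (s≤s q≤m) (ℕ.≤-trans m<α (ℕ.m≤m+n α β))) (begin-strict
      α + β       <⟨ ℕ.+-monoʳ-< α (ℕ.≰⇒> m≰β) ⟩
      α + m       ≤⟨ ℕ.+-monoˡ-≤ m α≤1+m ⟩
      1 + (m + m) ≤⟨ ℕ.+-mono-≤ 1≤q (ℕ.m≤m+n (m + m) ε) ⟩
      q + n       ∎))
    where open ℕ.≤-Reasoning

  -- When `A` reaches neither coordinate, both lie between 1 and m + 1 - ε. `H`·`H` suffices unless
  -- one of them is m + 1; this forces ε = 0 and the other to be at least m, so both fall within the
  -- range of `V`.
  rotation-nonzero : ∀ {a b q} → 1 ≤ q → q ≤ m → a ℤ.+ b ≈ + q → ShortX ((a , b) , false)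
  rotation-nonzero {a} {b} {q} 1≤q q≤m sum with A-or-small a | A-or-small b
  ... | inj₁ (p , p< , a≈) | _                  = rotation-AH p< 1≤q q≤m a≈ sum
  ... | inj₂ _             | inj₁ (p , p< , b≈) = rotation-HA p< 1≤q q≤m b≈ sum
  ... | inj₂ (α , 1≤α , α≤ , a≈) | inj₂ (β , 1≤β , β≤ , b≈) = small (α ℕ.≤? m) (β ℕ.≤? m)
    where
    α+β≈q : + α ℤ.+ + β ≈ + q
    α+β≈q = ≈-trans (+-cong (≈-sym a≈) (≈-sym b≈)) sum

    α≤1+m : α ≤ suc m
    α≤1+m = ℕ.≤-trans (ℕ.m≤m+n α ε) α≤

    β≤1+m : β ≤ suc m
    β≤1+m = ℕ.≤-trans (ℕ.m≤m+n β ε) β≤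

    large⇒even : ∀ {γ} → ¬ γ ≤ m → γ + ε ≤ suc m → ε ≡ 0
    large⇒even {γ} γ≰m γ≤ with ε-cases
    ... | inj₁ ε≡0 = ε≡0
    ... | inj₂ ε≡1 = contradiction (ℕ.s≤s⁻¹ (subst (_≤ suc m) (≡.trans (cong (λ e → γ + e) ε≡1) (ℕ.+-comm γ 1)) γ≤)) γ≰m

    antipodes : ε ≡ 0 → m ≤ α → m ≤ β → ShortX ((a , b) , false)
    antipodes ε≡0 m≤α m≤β =
      let _ , 1≤l , l≤m , a≈-l = antipode ε≡0 m≤α α≤1+m a≈
          _ , 1≤k , k≤m , b≈-k = antipode ε≡0 m≤β β≤1+m b≈
      in rotation-VV 1≤l l≤m 1≤k k≤m a≈-l b≈-k

    small : Dec (α ≤ m) → Dec (β ≤ m) → ShortX ((a , b) , false)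
    small (yes α≤m) (yes β≤m) = rotation-HH 1≤α α≤m 1≤β β≤m a≈ b≈
    small (no α≰m) _ = antipodes (large⇒even α≰m α≤) (ℕ.<⇒≤ (ℕ.≰⇒> α≰m))
      (both-large (ℕ.≰⇒> α≰m) α≤1+m q≤m 1≤q α+β≈q)
    small _ (no β≰m) = antipodes (large⇒even β≰m β≤)
      (both-large (ℕ.≰⇒> β≰m) β≤1+m q≤m 1≤q (≈-trans (reflexive (ℤ.+-comm (+ β) (+ α))) α+β≈q))
      (ℕ.<⇒≤ (ℕ.≰⇒> β≰m))

  split-double : ∀ {q} → q ≤ r + r → ∃₂ λ t t′ → t ≤ r × t′ ≤ r × t + t′ ≡ q
  split-double {q} q≤2r with q ℕ.≤? r
  ... | yes q≤r = q , 0 , q≤r , z≤n , ℕ.+-identityʳ q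
  ... | no  q≰r with j , j+r≡q ← ≤⇒∃+ (ℕ.<⇒≤ (ℕ.≰⇒> q≰r)) =
    j , r , ℕ.+-cancelʳ-≤ r j r (subst (_≤ r + r) (≡.sym j+r≡q) q≤2r) , ℕ.≤-refl , j+r≡q

  -- For ε = 1, `A` contains p = 0 and all p ≤ m. For ε = 0, products `T⁺`·`T⁺` have sum 2m, which
  -- vanishes, and first coordinates t + t′ filling the range from 0 to 2r.
  rotation-zero : ∀ {a b q} → q ≤ m → a ≈ + q → a ℤ.+ b ≈ + 0 → ShortX ((a , b) , false)
  rotation-zero {a} {b} {q} q≤m a≈ sum with ε-cases
  ... | inj₂ ε≡1 = product (A∈ {0} (ℕ.≤-trans 2≤m (ℕ.m≤m+n m (ε + ε)))) (A∈ {q} 2+q≤)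
      (from-fst (a≈ ⨾ ≡.sym (ℤ.+-identityˡ _)) sum (reflexive (lemma (+ q))) , refl)
    where
    lemma : ∀ q → (+ 0 ℤ.+ q) ℤ.+ (+ 0 ℤ.+ - q) ≡ + 0
    lemma = solve-∀
    2+q≤ : 2 + q ≤ m + (ε + ε)
    2+q≤ = subst (λ e → 2 + q ≤ m + (e + e)) (≡.sym ε≡1) (ℕ.≤-trans (s≤s (s≤s q≤m)) (ℕ.≤-reflexive (ℕ.+-comm 2 m)))
  ... | inj₁ ε≡0 with q ℕ.≤? r + r
  ...   | yes q≤2r with t , t′ , t≤r , t′≤r , refl ← split-double q≤2r =
      product (T⁺∈ t≤r) (T⁺∈ t′≤r)
        (from-fst a≈ sum (≈-trans (reflexive (lemma (+ m) (+ t) (+ t′))) (2m≈0 ε≡0)) , refl)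
    where
    lemma : ∀ m t t′ → (t ℤ.+ t′) ℤ.+ ((m ℤ.- t) ℤ.+ (m ℤ.- t′)) ≡ m ℤ.+ m
    lemma = solve-∀
  -- Only q = m = 2r + 1 is left, and then both coordinates are m.
  ...   | no q≰2r with refl ← ℕ.≤-antisym q≤m (ℕ.≤-trans m≤1+2r (ℕ.≰⇒> q≰2r)) =
      rotation-HH 1≤m ℕ.≤-refl 1≤m ℕ.≤-refl a≈ (proj₂ (from-fst a≈ sum (2m≈0 ε≡0)))
    where
    1≤m : 1 ≤ m
    1≤m = s≤s z≤n

  rotation-zero-sum : ∀ a b → a ℤ.+ b ≈ + 0 → ShortX ((a , b) , false)
  rotation-zero-sum a b sum with halves a
  ... | _ , k≤m , inj₁ a≈ = rotation-zero k≤m a≈ sum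
  ... | _ , k≤m , inj₂ a≈ = by-inverse (rotation-zero k≤m (neg-cong a≈ ⨾ ℤ.neg-involutive _) (neg-sum a b sum))

  rotation-short : ∀ a b → ShortX ((a , b) , false)
  rotation-short a b with halves (a ℤ.+ b)
  ... | zero  , _   , inj₁ sum = rotation-zero-sum a b sum
  ... | zero  , _   , inj₂ sum = rotation-zero-sum a b sum
  ... | suc q , q≤m , inj₁ sum = rotation-nonzero (s≤s z≤n) q≤m sum
  ... | suc q , q≤m , inj₂ sum = by-inverse (rotation-nonzero (s≤s z≤n) q≤m (neg-sum a b sum))

  -- Reflections as products of two generators.

  complement≤r : ∀ {t β} → t + β ≡ m → ¬ β ≤ r → t ≤ r
  complement≤r {t} {β} t+β≡m β≰r = ℕ.+-cancelʳ-≤ (suc r) t r (begin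
    t + suc r   ≤⟨ ℕ.+-monoʳ-≤ t (ℕ.≰⇒> β≰r) ⟩
    t + β       ≡⟨ t+β≡m ⟩
    m           ≤⟨ m≤1+2r ⟩
    suc (r + r) ≡⟨ ℕ.+-suc r r ⟨
    r + suc r   ∎)
    where open ℕ.≤-Reasoning

  -- To the right of `H`, an element of `T⁺` contributes t to the second coordinate; to the left it
  -- contributes m - t. As m ≤ 2r + 1, one of β and m - β is at most r.
  reflection-above : ∀ {a b q β} → 1 ≤ q → q ≤ m → β ≤ m →
                     a ℤ.+ b ≈ + m ℤ.+ + q → b ≈ + β → ShortX ((a , b) , true)
  reflection-above {a} {b} {q} {β} 1≤q q≤m β≤m sum b≈ with β ℕ.≤? r
  ... | yes β≤r = product (H∈ 1≤q q≤m) (T⁺∈ β≤r)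
      (from-snd (b≈ ⨾ ≡.sym (ℤ.+-identityˡ _)) sum (reflexive (lemma (+ m) (+ q) (+ β))) , refl)
    where
    lemma : ∀ m q β → (q ℤ.+ (m ℤ.- β)) ℤ.+ (+ 0 ℤ.+ β) ≡ m ℤ.+ q
    lemma = solve-∀
  ... | no β≰r with t , t+β≡m ← ≤⇒∃+ β≤m = product (T⁺∈ (complement≤r t+β≡m β≰r)) (H∈ 1≤q q≤m)
      (from-snd (b≈ ⨾ ≡.trans (lemma₁ (+ t) (+ β)) (cong (λ k → (+ k ℤ.- + t) ℤ.+ + 0) t+β≡m))
                sum (reflexive (lemma₂ (+ m) (+ q) (+ t))) , refl)
    where
    lemma₁ : ∀ t β → β ≡ ((t ℤ.+ β) ℤ.- t) ℤ.+ + 0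
    lemma₁ = solve-∀
    lemma₂ : ∀ m q t → (t ℤ.+ q) ℤ.+ ((m ℤ.- t) ℤ.+ + 0) ≡ m ℤ.+ q
    lemma₂ = solve-∀

  -- The same argument with `T⁻`, whose sum is -m and whose contributions to the second coordinate
  -- are negated.
  reflection-below : ∀ {a b q β} → 1 ≤ q → q ≤ m → β ≤ m →
                     a ℤ.+ b ≈ + q ℤ.- + m → b ≈ - + β → ShortX ((a , b) , true)
  reflection-below {a} {b} {q} {β} 1≤q q≤m β≤m sum b≈ with β ℕ.≤? r
  ... | yes β≤r = product (H∈ 1≤q q≤m) (T⁻∈ β≤r)
      (from-snd (b≈ ⨾ ≡.sym (ℤ.+-identityˡ _)) sum (reflexive (lemma (+ m) (+ q) (+ β))) , refl)
    where
    lemma : ∀ m q β → (q ℤ.+ (β ℤ.- m)) ℤ.+ (+ 0 ℤ.+ - β) ≡ q ℤ.- m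
    lemma = solve-∀
  ... | no β≰r with t , t+β≡m ← ≤⇒∃+ β≤m = product (T⁻∈ (complement≤r t+β≡m β≰r)) (H∈ 1≤q q≤m)
      (from-snd (b≈ ⨾ ≡.trans (lemma₁ (+ t) (+ β)) (cong (λ k → (+ t ℤ.- + k) ℤ.+ + 0) t+β≡m))
                sum (reflexive (lemma₂ (+ m) (+ q) (+ t))) , refl)
    where
    lemma₁ : ∀ t β → - β ≡ (t ℤ.- (t ℤ.+ β)) ℤ.+ + 0
    lemma₁ = solve-∀
    lemma₂ : ∀ m q t → (- t ℤ.+ q) ℤ.+ ((t ℤ.- m) ℤ.+ + 0) ≡ q ℤ.- m
    lemma₂ = solve-∀

  reflection-AT : ∀ {a b p t} → 2 + p ≤ m + (ε + ε) → t ≤ r →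
                  a ℤ.+ b ≈ + m → b ≈ + p ℤ.+ + t → ShortX ((a , b) , true)
  reflection-AT {p = p} {t} p≤ t≤r sum b≈ = product (A∈ p≤) (T⁺∈ t≤r)
    (from-snd b≈ sum (reflexive (lemma (+ m) (+ p) (+ t))) , refl)
    where
    lemma : ∀ m p t → (- p ℤ.+ (m ℤ.- t)) ℤ.+ (p ℤ.+ t) ≡ m
    lemma = solve-∀

  reflection-TA : ∀ {a b p} → 2 + p ≤ m + (ε + ε) →
                  a ℤ.+ b ≈ + m → b ≈ + m ℤ.+ + p → ShortX ((a , b) , true)
  reflection-TA {p = p} p≤ sum b≈ = product (T⁺∈ z≤n) (A∈ p≤)
    (from-snd (b≈ ⨾ lemma₁ (+ m) (+ p)) sum (reflexive (lemma₂ (+ m) (+ p))) , refl)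
    where
    lemma₁ : ∀ m p → m ℤ.+ p ≡ (m ℤ.- + 0) ℤ.+ p
    lemma₁ = solve-∀
    lemma₂ : ∀ m p → (+ 0 ℤ.+ - p) ℤ.+ ((m ℤ.- + 0) ℤ.+ p) ≡ m
    lemma₂ = solve-∀

  -- The last index of `A` when ε = 0, hence admissible for either ε.
  m₂ : ℕ
  m₂ = m ∸ 2

  2+m₂≡m : 2 + m₂ ≡ m
  2+m₂≡m = ℕ.m+[n∸m]≡n 2≤m

  m₂-bound : 2 + m₂ ≤ m + (ε + ε)
  m₂-bound = ℕ.≤-trans (ℕ.≤-reflexive 2+m₂≡m) (ℕ.m≤m+n m (ε + ε))

  -- Taking t = 1 and p = m - 2 gives second coordinate (1 - m) + (m - 2) = -1 and sum -m, which is
  -- m modulo 2m.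
  reflection-minus-one : ε ≡ 0 → ∀ {a b} → a ℤ.+ b ≈ + m → b ≈ - + 1 → ShortX ((a , b) , true)
  reflection-minus-one ε≡0 {a} {b} sum b≈ = product (T⁻∈ 1≤r) (A∈ m₂-bound)
    (from-snd (b≈ ⨾ ≡.trans (lemma₁ (+ m₂)) (cong (λ k → (+ 1 ℤ.- + k) ℤ.+ + m₂) 2+m₂≡m)) sum
      (≈-trans (reflexive (lemma₂ (+ m₂) (+ m))) -m≈m) , refl)
    where
    lemma₁ : ∀ x → - + 1 ≡ (+ 1 ℤ.- (+ 2 ℤ.+ x)) ℤ.+ x
    lemma₁ = solve-∀
    lemma₂ : ∀ x m → (- + 1 ℤ.+ - x) ℤ.+ ((+ 1 ℤ.- m) ℤ.+ x) ≡ - m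
    lemma₂ = solve-∀
    -m≈m : - + m ≈ + m
    -m≈m = proj₁ (from-snd {b = + m} (reflexive refl) (reflexive (ℤ.+-inverseˡ (+ m))) (2m≈0 ε≡0))

  -- `A`·`T⁺` with t = 0 gives the second coordinates from 0 to m - 2 + 2ε, and `T⁺`·`A` with t = 0
  -- those from m to 2m - 2 + 2ε. For ε = 1 this is everything; for ε = 0 only m - 1 and n - 1 are
  -- missing.
  reflection-m : ∀ {a b} → a ℤ.+ b ≈ + m → ShortX ((a , b) , true)
  reflection-m {a} {b} sum with k , k<n , b≈ ← residue b with 2 + k ℕ.≤? m + (ε + ε) | m ℕ.≤? k
  ... | yes 2+k≤ | _      = reflection-AT 2+k≤ z≤n sum (b≈ ⨾ ≡.sym (ℤ.+-identityʳ (+ k)))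
  -- Now k = m - 1 = (m - 2) + 1, reached with t = 1; this is where 1 ≤ r matters.
  ... | no  2+k≰ | no m≰k = reflection-AT m₂-bound 1≤r sum (b≈ ⨾ cong +_ k≡m₂+1)
    where
    k≡m₂+1 : k ≡ m₂ + 1
    k≡m₂+1 = ℕ.suc-injective (begin-equality
      suc k        ≡⟨ ℕ.≤-antisym (ℕ.≰⇒> m≰k) (ℕ.≤-trans (ℕ.m≤m+n m (ε + ε)) (ℕ.s≤s⁻¹ (ℕ.≰⇒> 2+k≰))) ⟩
      m            ≡⟨ 2+m₂≡m ⟨
      2 + m₂       ≡⟨ cong suc (ℕ.+-comm 1 m₂) ⟩
      suc (m₂ + 1) ∎)
      where open ℕ.≤-Reasoning
  ... | no  _    | yes m≤k with p , p+m≡k ← ≤⇒∃+ m≤k with 2 + p ℕ.≤? m + (ε + ε)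
  ...   | yes 2+p≤ = reflection-TA 2+p≤ sum (b≈ ⨾ cong +_ (≡.trans (≡.sym p+m≡k) (ℕ.+-comm p m)))
  -- The bounds m + 2ε ≤ p + 1 ≤ m + ε force ε = 0 and k = n - 1.
  ...   | no  2+p≰ = reflection-minus-one ε≡0 sum (wrap b≈ k+1≡n)
    where
    open ℕ.≤-Reasoning
    m+2ε≤1+p : m + (ε + ε) ≤ suc p
    m+2ε≤1+p = ℕ.s≤s⁻¹ (ℕ.≰⇒> 2+p≰)
    1+p≤m+ε : suc p ≤ m + ε
    1+p≤m+ε = ℕ.+-cancelʳ-≤ m (suc p) (m + ε) (begin
      suc p + m   ≡⟨ cong suc p+m≡k ⟩
      suc k       ≤⟨ k<n ⟩
      m + m + ε   ≡⟨ lemma m ε ⟩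
      m + ε + m   ∎)
      where
      lemma : ∀ m ε → m + m + ε ≡ m + ε + m
      lemma = ℕ.solve-∀
    ε≡0 : ε ≡ 0
    ε≡0 = ℕ.n≤0⇒n≡0 (ℕ.+-cancelˡ-≤ (m + ε) ε 0 (begin
      m + ε + ε   ≡⟨ ℕ.+-assoc m ε ε ⟩
      m + (ε + ε) ≤⟨ m+2ε≤1+p ⟩
      suc p       ≤⟨ 1+p≤m+ε ⟩
      m + ε       ≡⟨ ℕ.+-identityʳ (m + ε) ⟨
      m + ε + 0   ∎))
    k+1≡n : k + 1 ≡ n
    k+1≡n = ℕ.≤-antisym (subst (_≤ n) (ℕ.+-comm 1 k) k<n) (begin
      m + m + ε           ≤⟨ ℕ.m≤m+n (m + m + ε) ε ⟩
      m + m + ε + ε       ≡⟨ lemma m ε ⟩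
      m + (ε + ε) + m     ≤⟨ ℕ.+-monoˡ-≤ m m+2ε≤1+p ⟩
      suc p + m           ≡⟨ cong suc p+m≡k ⟩
      suc k               ≡⟨ ℕ.+-comm 1 k ⟩
      k + 1               ∎)
      where
      lemma : ∀ m ε → m + m + ε + ε ≡ m + (ε + ε) + m
      lemma = ℕ.solve-∀

  reflection-single : ε ≡ 1 → ∀ {a b β} → β ≤ m → a ℤ.+ b ≈ + 0 → b ≈ + β → ShortX ((a , b) , true)
  reflection-single ε≡1 {β = β} β≤m sum b≈ = single (X-resp-≈ {(- + β , + β) , true}
    (swap (from-snd b≈ sum (reflexive (ℤ.+-inverseˡ (+ β)))) , refl) (A∈ 2+β≤))
    where
    swap : ∀ {a b α β} → a ≈ α × b ≈ β → α ≈ a × β ≈ b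
    swap (p , q) = ≈-sym p , ≈-sym q
    2+β≤ : 2 + β ≤ m + (ε + ε)
    2+β≤ = subst (λ e → 2 + β ≤ m + (e + e)) (≡.sym ε≡1) (ℕ.≤-trans (s≤s (s≤s β≤m)) (ℕ.≤-reflexive (ℕ.+-comm 2 m)))

  -- Put q = m - τ. For q = 0 the inverse has sum m. Otherwise -τ is both q - m and, modulo n, m +
  -- (q + ε); the sign of the second coordinate selects `T⁻` or `T⁺`.
  reflection-nonpositive : ∀ {a b τ} → τ ≤ m → a ℤ.+ b ≈ - + τ → ShortX ((a , b) , true)
  reflection-nonpositive {a} {b} {τ} τ≤m sum with ≤⇒∃+ τ≤m
  ... | zero  , refl    = by-inverse (reflection-m (neg-sum′ a b sum))
    where
    neg-sum′ : ∀ a b → a ℤ.+ b ≈ - + m → - b ℤ.+ - a ≈ + m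
    neg-sum′ a b sum = ≈-trans (reflexive (ℤ.+-comm (- b) (- a))) (neg-sum a b sum)
  ... | suc q , q+τ≡m with halves b
  ...   | β , β≤m , inj₂ b≈ = reflection-below (s≤s z≤n) q≤m β≤m
      (sum ⨾ ≡.trans (lemma (+ suc q) (+ τ)) (cong (λ k → + suc q ℤ.- + k) q+τ≡m)) b≈
    where
    q≤m : suc q ≤ m
    q≤m = subst (suc q ≤_) q+τ≡m (ℕ.m≤m+n (suc q) τ)
    lemma : ∀ q τ → - τ ≡ q ℤ.- (q ℤ.+ τ)
    lemma = solve-∀
  ...   | β , β≤m , inj₁ b≈ with suc q + ε ℕ.≤? m
  ...     | yes q+ε≤m = reflection-above (s≤s z≤n) q+ε≤m β≤m
      (≈-trans sum (≈-sym (wrap (reflexive refl) m+q+ε+τ≡n))) b≈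
    where
    lemma : ∀ m q ε τ → m + (q + ε) + τ ≡ m + (q + τ) + ε
    lemma = ℕ.solve-∀
    m+q+ε+τ≡n : m + (suc q + ε) + τ ≡ n
    m+q+ε+τ≡n = ≡.trans (lemma m (suc q) ε τ) (cong (λ k → m + k + ε) q+τ≡m)
  -- Since q ≤ m, this leaves ε = 1 and q = m, that is sum 0, where the reflection itself is in `A`.
  ...     | no  q+ε≰m = odd ε-cases
    where
    odd : ε ≡ 0 ⊎ ε ≡ 1 → ShortX ((a , b) , true)
    odd (inj₁ ε≡0) = contradiction
      (subst (λ e → suc q + e ≤ m) (≡.sym ε≡0) (subst (suc q + 0 ≤_) q+τ≡m (ℕ.+-monoʳ-≤ (suc q) z≤n))) q+ε≰m
    odd (inj₂ ε≡1) = reflection-single ε≡1 β≤m (sum ⨾ cong (λ t → - + t) τ≡0) b≈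
      where
      τ≡0 : τ ≡ 0
      τ≡0 = ℕ.n<1⇒n≡0 (ℕ.+-cancelˡ-< (suc q) τ 1 (subst (_< suc q + 1) (≡.sym q+τ≡m)
              (subst (λ e → m < suc q + e) ε≡1 (ℕ.≰⇒> q+ε≰m))))

  reflection-short : ∀ a b → ShortX ((a , b) , true)
  reflection-short a b with halves (a ℤ.+ b)
  ... | τ , τ≤m , inj₂ sum = reflection-nonpositive τ≤m sum
  ... | τ , τ≤m , inj₁ sum = by-inverse (reflection-nonpositive τ≤m
      (≈-trans (reflexive (lemma a b)) (neg-cong sum)))
    where
    lemma : ∀ a b → - b ℤ.+ - a ≡ - (a ℤ.+ b)
    lemma = solve-∀

  short : ∀ g → ShortX g
  short ((a , b) , false) = rotation-short a b
  short ((a , b) , true)  = reflection-short a b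

  -- Counting the generators: no two indices give the same element.

  index-order : Index ↔ Fin ((m + m) + ((m₁ + (ε + ε)) + (suc r + (r + ε))))
  index-order = ⊎-order (⊎-order (↔-id _) (↔-id _)) (⊎-order (↔-id _) (⊎-order (↔-id _) (↔-id _)))

  neg-cancel : ∀ {x y} → - x ≈ - y → x ≈ y
  neg-cancel {x} {y} p = ≈-trans (reflexive (≡.sym (ℤ.neg-involutive x))) (neg-cong p ⨾ ℤ.neg-involutive y)

  A-bound : ∀ (i : Fin (m₁ + (ε + ε))) → toℕ i < n
  A-bound i = begin-strict
    toℕ i          <⟨ Fin.toℕ<n i ⟩
    m₁ + (ε + ε)   ≡⟨ ℕ.+-assoc m₁ ε ε ⟨
    m₁ + ε + ε     ≤⟨ ℕ.+-monoˡ-≤ ε (ℕ.+-mono-≤ (ℕ.n≤1+n m₁) (ℕ.≤-trans ε≤1 (s≤s z≤n))) ⟩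
    m + m + ε      ∎
    where open ℕ.≤-Reasoning

  T-bound : ∀ {t} → t ≤ r → t < n
  T-bound t≤r = ≤m⇒<n (ℕ.≤-trans t≤r r≤m)

  suc≉0 : ∀ (i : Fin m) → ¬ + suc (toℕ i) ≈ + 0
  suc≉0 i p with () ← small-zero (≤m⇒<n (Fin.toℕ<n i)) p

  -- The second coordinate 0 forces p = 0, hence first coordinate 0, whereas the values 1 to m are
  -- nonzero modulo n.
  H≢A : ∀ i j → ¬ element (H i) ≋ element (A j)
  H≢A i j ((p , q) , _) = suc≉0 i (p ⨾ cong (λ k → - + k) (small-zero (A-bound j) (≈-sym q)))

  V≢A : ∀ i j → ¬ element (V i) ≋ element (A j)
  V≢A i j ((p , q) , _) = suc≉0 i (neg-cancel (q ⨾ cong +_ (small-zero (A-bound j) (≈-sym (neg-cancel p)))))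

  -- First coordinates give t + t′ = 0 modulo n; as t + t′ ≤ 2r ≤ m < n, both vanish. But t′ = 0
  -- requires ε = 1, and then the second coordinates would make 2m divisible by n = 2m + 1.
  T⁺≢T⁻ : ∀ i j → ¬ element (T⁺ i) ≋ element (T⁻ j)
  T⁺≢T⁻ i j ((p , q) , _) = contradiction (small-zero 2m<n m+m≈0) λ ()
    where
    t = toℕ i
    t′ = (1 ∸ ε) + toℕ j
    t+t′≡0 : t + t′ ≡ 0
    t+t′≡0 = small-zero
      (≤m⇒<n (ℕ.≤-trans (ℕ.+-mono-≤ (ℕ.s≤s⁻¹ (Fin.toℕ<n i)) (T⁻-bound j)) 2r≤m))
      (+-cong p (reflexive refl) ⨾ ℤ.+-inverseˡ (+ t′))
    t≡0 : t ≡ 0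
    t≡0 = ℕ.m+n≡0⇒m≡0 t t+t′≡0
    t′≡0 : t′ ≡ 0
    t′≡0 = ℕ.m+n≡0⇒n≡0 t t+t′≡0
    2m<n : m + m < n
    2m<n = ℕ.≤-trans (ℕ.≤-reflexive (ℕ.+-comm 1 (m + m)))
      (ℕ.+-monoʳ-≤ (m + m) (ℕ.m∸n≡0⇒m≤n (ℕ.m+n≡0⇒m≡0 (1 ∸ ε) t′≡0)))
    m+m≈0 : + m ℤ.+ + m ≈ + 0
    m+m≈0 = ≈-trans (reflexive (cong (λ k → k ℤ.+ + m) (≡.sym (ℤ.+-identityʳ (+ m)))))
      (≈-trans (+-cong {u = + m} (subst (λ k → + m ℤ.- + k ≈ + t′ ℤ.- + m) t≡0 q) (reflexive refl))
        (reflexive (≡.trans (cong (λ k → (+ k ℤ.- + m) ℤ.+ + m) t′≡0) (lemma (+ m)))))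
      where
      lemma : ∀ m → (+ 0 ℤ.- m) ℤ.+ m ≡ + 0
      lemma = solve-∀

  element-injective : ∀ i j → element i ≋ element j → i ≡ j
  element-injective (H i) (H j) ((p , _) , _) = cong H
    (Fin.toℕ-injective (ℕ.suc-injective (small-injective (≤m⇒<n (Fin.toℕ<n i)) (≤m⇒<n (Fin.toℕ<n j)) p)))
  element-injective (V i) (V j) ((_ , q) , _) = cong V
    (Fin.toℕ-injective (ℕ.suc-injective (small-injective (≤m⇒<n (Fin.toℕ<n i)) (≤m⇒<n (Fin.toℕ<n j)) (neg-cancel q))))
  element-injective (A i) (A j) ((_ , q) , _) = cong A
    (Fin.toℕ-injective (small-injective (A-bound i) (A-bound j) q))
  element-injective (T⁺ i) (T⁺ j) ((p , _) , _) = cong T⁺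
    (Fin.toℕ-injective (small-injective (T-bound (ℕ.s≤s⁻¹ (Fin.toℕ<n i))) (T-bound (ℕ.s≤s⁻¹ (Fin.toℕ<n j))) p))
  element-injective (T⁻ i) (T⁻ j) ((p , _) , _) = cong T⁻
    (Fin.toℕ-injective (ℕ.+-cancelˡ-≡ (1 ∸ ε) _ _ (small-injective (T-bound (T⁻-bound i)) (T-bound (T⁻-bound j)) (neg-cancel p))))
  element-injective (H i) (V j) ((p , _) , _) = contradiction p (suc≉0 i)
  element-injective (V i) (H j) ((p , _) , _) = contradiction (≈-sym p) (suc≉0 j)
  element-injective (H i) (A j) p = contradiction p (H≢A i j)
  element-injective (A i) (H j) p = contradiction (Group.sym W {element (A i)} p) (H≢A j i)
  element-injective (V i) (A j) p = contradiction p (V≢A i j)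
  element-injective (A i) (V j) p = contradiction (Group.sym W {element (A i)} p) (V≢A j i)
  element-injective (T⁺ i) (T⁻ j) p = contradiction p (T⁺≢T⁻ i j)
  element-injective (T⁻ i) (T⁺ j) p = contradiction (Group.sym W {element (T⁻ i)} p) (T⁺≢T⁻ j i)
  element-injective (H _) (T⁺ _) (_ , ())
  element-injective (H _) (T⁻ _) (_ , ())
  element-injective (V _) (T⁺ _) (_ , ())
  element-injective (V _) (T⁻ _) (_ , ())
  element-injective (A _) (T⁺ _) (_ , ())
  element-injective (A _) (T⁻ _) (_ , ())
  element-injective (T⁺ _) (H _) (_ , ())
  element-injective (T⁺ _) (V _) (_ , ())
  element-injective (T⁺ _) (A _) (_ , ())
  element-injective (T⁻ _) (H _) (_ , ())
  element-injective (T⁻ _) (V _) (_ , ())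
  element-injective (T⁻ _) (A _) (_ , ())

  -- The diameter and the assembled graph.

  m≉0 : ¬ + m ≈ + 0
  m≉0 p with () ← small-zero m<n p

  -- Rotations in the connection set have sum m or -m, neither of which is 0. This excludes the unit
  -- and also certifies a vertex not adjacent to it.
  sum-zero∉X : ∀ {a b} → a ℤ.+ b ≈ + 0 → ¬ X ((a , b) , false)
  sum-zero∉X sum (T⁺ i , (p , q) , _) =
    m≉0 (≈-trans (reflexive (lemma (+ m) (+ toℕ i))) (≈-trans (≈-sym (+-cong p q)) sum))
    where
    lemma : ∀ m t → m ≡ t ℤ.+ (m ℤ.- t)
    lemma = solve-∀
  sum-zero∉X sum (T⁻ i , (p , q) , _) =
    m≉0 (neg-cancel (≈-trans (reflexive (lemma (+ m) (+ ((1 ∸ ε) + toℕ i)))) (≈-trans (≈-sym (+-cong p q)) sum)))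
    where
    lemma : ∀ m t → - m ≡ - t ℤ.+ (t ℤ.- m)
    lemma = solve-∀
  sum-zero∉X _ (H _ , _ , ())
  sum-zero∉X _ (V _ , _ , ())
  sum-zero∉X _ (A _ , _ , ())

  connectionSet : ConnectionSet W
  connectionSet = record
    { X              = X
    ; X-resp-≈       = λ {g} {h} → X-resp-≈ {g} {h}
    ; unit-free      = sum-zero∉X (reflexive refl)
    ; inverse-closed = λ {g} → inverse-closed {g}
    ; generating     = λ g → short⇒generated W (short g)
    }

  -- Checking these at connectionSet itself is slow: Agda then unfolds all of its proofs.
  degree : ∀ S → ConnectionSet.X S ≡ X →
           CayHasDegree W S ((m + m) + ((m₁ + (ε + ε)) + (suc r + (r + ε))))
  degree = image-degree index-order element-injective

  diameter : ∀ S → ConnectionSet.X S ≡ X → HasDiameter (Cay W S) 2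
  diameter S refl = hasDiameter-two W S _≟_ (Image? index-order _≟_) short
    -- A rotation of sum 0 other than the unit, hence at distance two from it.
    ((+ 1 , - + 1) , false) nontrivial (sum-zero∉X (reflexive refl))
    where
    _≟_ : ∀ g h → Dec (g ≋ h)
    _≟_ = cardinality⇒≈? (wreath-order ℤ/n ℤ/n-order)

    nontrivial : ¬ ((+ 1 , - + 1) , false) ≋ Group.ε W
    nontrivial ((p , _) , _) with () ← small-zero (ℕ.≤-trans (s≤s (s≤s z≤n)) m<n) p

  constructed : (S : ConnectionSet W) → ConnectionSet.X S ≡ X → Σ[ Γ ∈ Group 0ℓ 0ℓ ] Σ[ S ∈ ConnectionSet Γ ]
    ( HasDiameter (Cay Γ S) 2
    × CayHasDegree Γ S ((m + m) + ((m₁ + (ε + ε)) + (suc r + (r + ε))))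
    × HasOrder (Cay Γ S) (n * n * 2) )
  constructed S S≡ = W , S , diameter S S≡ , degree S S≡ , wreath-order ℤ/n ℤ/n-order

  result : Σ[ Γ ∈ Group 0ℓ 0ℓ ] Σ[ S ∈ ConnectionSet Γ ]
    ( HasDiameter (Cay Γ S) 2
    × CayHasDegree Γ S ((m + m) + ((m₁ + (ε + ε)) + (suc r + (r + ε))))
    × HasOrder (Cay Γ S) (n * n * 2) )
  result = constructed connectionSet refl

-- Arithmetic of the degree and the order.

reindex : ∀ {d d′ N M} → d ≡ d′ → 2 * N ≡ M →
  Σ[ Γ ∈ Group 0ℓ 0ℓ ] Σ[ S ∈ ConnectionSet Γ ]
    (HasDiameter (Cay Γ S) 2 × CayHasDegree Γ S d × HasOrder (Cay Γ S) N) →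
  Σ[ Γ ∈ Group 0ℓ 0ℓ ] Σ[ S ∈ ConnectionSet Γ ]
    (HasDiameter (Cay Γ S) 2 × CayHasDegree Γ S d′ × (∃[ N ] (HasOrder (Cay Γ S) N × 2 * N ≡ M)))
reindex refl eq (Γ , S , diameter , degree , order) = Γ , S , diameter , degree , _ , order , eq

theorem1 : (r s ε : ℕ) → 1 ≤ r → s ≤ 1 → ε ≤ 1 →
    let n = 4 * r + 2 * s + ε
        d = (2 * n ∸ s) + ε
    in Σ[ Γ ∈ Group 0ℓ 0ℓ ] Σ[ S ∈ ConnectionSet Γ ]
         ( HasDiameter (Cay Γ S) 2
         × CayHasDegree Γ S d
         × (∃[ N ] (HasOrder (Cay Γ S) N × 2 * N ≡ ((d + s) ∸ ε) ^ 2)) )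
theorem1 (suc r′) s ε 1≤r s≤1 ε≤1 =
  reindex degree≡ order≡ (Construction.result r m₁ ε 1≤r ε≤1 2r≤m m≤1+2r)
  where
  r m₁ n : ℕ
  r  = suc r′
  -- Chosen so that `suc m₁` computes to r + r + s.
  m₁ = r′ + r + s
  n  = suc m₁ + suc m₁ + ε

  2r≤m : r + r ≤ suc m₁
  2r≤m = ℕ.m≤m+n (r + r) s

  m≤1+2r : suc m₁ ≤ suc (r + r)
  m≤1+2r = ℕ.≤-trans (ℕ.+-monoʳ-≤ (r + r) s≤1) (ℕ.≤-reflexive (ℕ.+-comm (r + r) 1))

  -- This is 2n - s in a form free of truncated subtraction.
  D : ℕ
  D = 8 * r + 3 * s + 2 * ε

  2n≡D+s : 2 * (4 * r + 2 * s + ε) ≡ D + s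
  2n≡D+s = lemma r s ε
    where
    lemma : ∀ r s ε → 2 * (4 * r + 2 * s + ε) ≡ 8 * r + 3 * s + 2 * ε + s
    lemma = ℕ.solve-∀

  D≡ : 2 * (4 * r + 2 * s + ε) ∸ s ≡ D
  D≡ = ≡.trans (cong (_∸ s) 2n≡D+s) (ℕ.m+n∸n≡m D s)

  degree≡ : (suc m₁ + suc m₁) + ((m₁ + (ε + ε)) + (suc r + (r + ε))) ≡ (2 * (4 * r + 2 * s + ε) ∸ s) + ε
  degree≡ = ≡.trans (lemma r′ s ε) (cong (_+ ε) (≡.sym D≡))
    where
    lemma : ∀ r′ s ε →
            1 + (r′ + (1 + r′) + s) + (1 + (r′ + (1 + r′) + s)) + (r′ + (1 + r′) + s + (ε + ε) + (2 + r′ + (1 + r′ + ε)))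
            ≡ 8 * (1 + r′) + 3 * s + 2 * ε + ε
    lemma = ℕ.solve-∀

  -- Since d + s - ε = 2n, half of its square is 2n², the order of the wreath product.
  order≡ : 2 * (n * n * 2) ≡ ((2 * (4 * r + 2 * s + ε) ∸ s) + ε + s ∸ ε) ^ 2
  order≡ = ≡.trans (square n) (cong (_^ 2) (≡.sym (begin
    (2 * (4 * r + 2 * s + ε) ∸ s) + ε + s ∸ ε   ≡⟨ cong (λ k → k + ε + s ∸ ε) D≡ ⟩
    D + ε + s ∸ ε                               ≡⟨ cong (_∸ ε) (swap D ε s) ⟩
    D + s + ε ∸ ε                               ≡⟨ ℕ.m+n∸n≡m (D + s) ε ⟩
    D + s                                       ≡⟨ lemma r s ε ⟩
    2 * n                                       ∎)))
    where
    open ≡.≡-Reasoning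
    square : ∀ n → 2 * (n * n * 2) ≡ 2 * n * (2 * n * 1)
    square = ℕ.solve-∀
    swap : ∀ a b c → a + b + c ≡ a + c + b
    swap = ℕ.solve-∀
    lemma : ∀ r s ε → 8 * r + 3 * s + 2 * ε + s ≡ 2 * (r + r + s + (r + r + s) + ε)
    lemma = ℕ.solve-∀
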